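{- Let $Q$ be a quiver arising from a triangulation of a marked bordered surface without punctures. For a vertex $k$ of $Q$, the following conditions are equivalent: (i) $k$ has in-degree $1$ and out-degree $1$. (ii) The quivers $Q$ and $\mu_k(Q)$ do not have the same number of arrows.
   Context: A quiver is a finite directed graph in which multiple arrows are allowed; quivers have no loops and no $2$-cycles. The in-degree (out-degree) of a vertex is the number of arrows ending (starting) at it. The mutation $\mu_k(Q)$ of $Q$ at a vertex $k$ is obtained by: (1) for every pair of arrows $i\to k$, $k\to j$ adding a new arrow $i\to j$; (2) reversing all arrows starting or ending at $k$; (3) removing a maximal set of $2$-cycles. A marked bordered surface without punctures $(S,M)$ consists of a compact connected oriented surface $S$ with non-empty boundary and a finite set $M\subset\partial S$ containing at least one point of each boundary component. The marked points cut the boundary into boundary segments. An arc is a curve in $S$, up to isotopy relative to $M$, with endpoints in $M$, without self-intersections except that its endpoints may coincide, whose interior is disjoint from $\partial S$, and which is neither contractible to a point of $M$ nor isotopic to a boundary segment. A triangulation is a collection of distinct arcs, having representatives with pairwise disjoint interiors, which cuts $S$ into triangles (sides are arcs or boundary segments). The quiver $Q$ of a triangulation has the arcs as vertices, and for each triangle and each pair of its sides $i,j$ that are arcs with $j$ following $i$ in the clockwise order of the triangle, an arrow $i\to j$; then a maximal set of $2$-cycles is removed. -}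

module Defs where

open import Data.Bool using (Bool; not; if_then_else_; _∧_)
open import Data.Fin using (Fin; zero; suc; _≟_)
open import Data.Nat using (ℕ; _+_; _*_; _∸_; NonZero)
open import Data.Nat.Properties using (+-0-commutativeMonoid; n∸n≡0; m≤n⇒m∸n≡0; ≤-total)
open import Data.Product using (∃; ∃₂; _×_; _,_; proj₁)
open import Data.Sum using (_⊎_; inj₁; inj₂; map₁)
import Data.Sum as Sum
open import Data.Sum.Properties using (≡-dec)
open import Function using (_∘_)
open import Function.Bundles using (_↔_; Inverse)
open import Relation.Binary.Construct.Closure.Equivalence using (EqClosure)
open import Relation.Binary.PropositionalEquality using (_≡_)
open import Relation.Nullary using (does)
open import Relation.Nullary.Decidable using (_⊎-dec_)

open import Algebra.Properties.CommutativeMonoid.Sum +-0-commutativeMonoid public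
  using (sum; sum-syntax)

------------------------------------------------------------------------
-- Quivers

-- A finite directed multigraph on n vertices, given by its numbers of
-- arrows: G i j is the number of arrows i → j.
Multigraph : ℕ → Set
Multigraph n = Fin n → Fin n → ℕ

record Quiver (n : ℕ) : Set where
  field
    arrows      : Multigraph n
    noLoops     : ∀ i → arrows i i ≡ 0
    noTwoCycles : ∀ i j → arrows i j ≡ 0 ⊎ arrows j i ≡ 0

open Quiver public

outDegree inDegree : ∀ {n} → Quiver n → Fin n → ℕ
outDegree {n} Q i = ∑[ j < n ] arrows Q i j
inDegree  {n} Q i = ∑[ j < n ] arrows Q j i

numArrows : ∀ {n} → Quiver n → ℕ
numArrows {n} Q = ∑[ i < n ] ∑[ j < n ] arrows Q i j

-- A maximal set of 2-cycles on {i , j} consists of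
-- min (G i j) (G j i) pairs, so G i j ∸ G j i arrows i → j survive.
-- Loops would be deleted as well, but there are none wherever this is
-- used: mutating a quiver creates no loop, and neither does an
-- unpunctured triangulation.
removeTwoCycles : ∀ {n} → Multigraph n → Quiver n
removeTwoCycles G = record
  { arrows      = λ i j → G i j ∸ G j i
  ; noLoops     = λ i → n∸n≡0 (G i i)
  ; noTwoCycles = λ i j → Sum.map m≤n⇒m∸n≡0 m≤n⇒m∸n≡0 (≤-total (G i j) (G j i))
  }

addComposites : ∀ {n} → Fin n → Multigraph n → Multigraph n
addComposites k G i j = G i j + G i k * G k j

reverseAt : ∀ {n} → Fin n → Multigraph n → Multigraph n
reverseAt k G i j = if does ((i ≟ k) ⊎-dec (j ≟ k)) then G j i else G i j

mutate : ∀ {n} → Fin n → Quiver n → Quiver n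
mutate k Q = removeTwoCycles (reverseAt k (addComposites k (arrows Q)))

------------------------------------------------------------------------
-- Triangulated surfaces

-- The sides of an oriented triangle are numbered 0, 1, 2 in clockwise
-- order.
clockwise : Fin 3 → Fin 3
clockwise zero             = suc zero
clockwise (suc zero)       = suc (suc zero)
clockwise (suc (suc zero)) = zero

-- A compact oriented surface cut into triangles is recorded by the
-- triangles and the way their sides fit together.  The sides of the
-- triangles are the two banks of each arc, together with the boundary
-- segments.  Which of the two banks of an arc is called true and which
-- false is immaterial.  The two banks of an arc are glued so as to
-- match the orientations of the triangles: if both are traversed
-- clockwise around their own triangle, the start of one is glued to
-- the end of the other.
record Gluing : Set where
  field
    triangles arcs segments : ℕ

  Side : Set
  Side = Fin triangles × Fin 3

  field
    sides : Side ↔ ((Fin arcs × Bool) ⊎ Fin segments)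

  bank : Side → (Fin arcs × Bool) ⊎ Fin segments
  bank = Inverse.to sides

  label : Side → Fin arcs ⊎ Fin segments
  label = map₁ proj₁ ∘ bank

  next : Side → Side
  next (t , c) = t , clockwise c

  GluedTo : Side → Side → Set
  GluedTo x y = ∃₂ λ a b → bank x ≡ inj₁ (a , b) × bank y ≡ inj₁ (a , not b)

  OnBoundary : Side → Set
  OnBoundary x = ∃ λ s → bank x ≡ inj₂ s

  Adjacent : Fin triangles → Fin triangles → Set
  Adjacent t u = ∃₂ λ c d → GluedTo (t , c) (u , d)

  Connected : Set
  Connected = ∀ t u → EqClosure Adjacent t u

  -- A side x also stands for the corner of its triangle where x ends
  -- and next x starts (in clockwise direction).  Gluing next x to y
  -- identifies the corners x and y; the points of the surface which
  -- are vertices of triangles are the classes of corners under the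
  -- equivalence relation this generates.
  SamePoint : Side → Side → Set
  SamePoint = EqClosure (λ x y → GluedTo (next x) y)

  -- Every vertex of a triangle lies on the boundary of the surface,
  -- i.e. is an endpoint of a boundary segment.
  Unpunctured : Set
  Unpunctured = ∀ x → ∃ λ y → SamePoint x y × (OnBoundary y ⊎ OnBoundary (next y))

  -- The number of arrows i → j before the removal of 2-cycles.
  turns : Multigraph arcs
  turns i j = ∑[ t < triangles ] ∑[ c < 3 ]
    (if does (≡-dec _≟_ _≟_ (label (t , c)) (inj₁ i))
        ∧ does (≡-dec _≟_ _≟_ (label (next (t , c))) (inj₁ j))
     then 1 else 0)

-- A triangulation of a marked bordered surface without punctures
-- (S , M), with S the surface obtained by the gluing and M the set of
-- the vertices of the triangles.  That ∂S is non-empty and that each of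
-- its components meets M follows from the axioms, as there is at least
-- one triangle.
record Triangulation : Set where
  field
    gluing      : Gluing
    nonEmpty    : NonZero (Gluing.triangles gluing)
    connected   : Gluing.Connected gluing
    unpunctured : Gluing.Unpunctured gluing

  open Gluing gluing public

open Triangulation public using (arcs)

quiver : (T : Triangulation) → Quiver (arcs T)
quiver T = removeTwoCycles (Triangulation.turns T)

{-# OPTIONS --safe #-}
-- In an unpunctured surface, rotating about a vertex of the triangulation
-- always runs into the boundary, so no cyclic sequence of corners is glued
-- all the way round.  This rules out self-folded triangles and 2-cycles among
-- the turns.
--
-- Let the two triangles at k have sides k, a, b and k, c, d in clockwise
-- order, so that b, d → k → a, c.  Mutation adds arrows b → a and d → c
-- against the arrows of the two triangles, which cancels: each removes one
-- arrow.  It adds arrows b → c and d → a, and there each creates an arrow,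
-- since an arrow c → b or a → d would close up a cycle of corners.  This
-- count stays right when a = c or b = d: then half of the new arrows cancel
-- and the other half survive.  Writing α, β, γ, δ ∈ {0 , 1} for whether
-- a, b, c, d are arcs rather than boundary segments,
-- the number of arrows thus changes by (βγ + δα) − (βα + δγ) = (β − δ)(γ − α),
-- which is non-zero iff β + δ = 1 and α + γ = 1.
module Submission where

open import Defs
open import Data.Fin using (Fin)
open import Data.Product using (_×_)
open import Function.Bundles using (_⇔_)
open import Relation.Binary.PropositionalEquality using (_≡_; _≢_)

open import Data.Bool using (Bool; true; false; not; if_then_else_; _∧_)
open import Data.Bool.Properties using (∨-comm; not-involutive; ¬-not) renaming (_≟_ to _≟ᵇ_)
open import Data.Fin using (zero; suc; punchIn; _≟_)
open import Data.Fin.Properties using (punchInᵢ≢i)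
open import Data.Nat using (ℕ; zero; suc; _+_; _*_; _∸_; _≤_; z≤n; s≤s) renaming (_≟_ to _≟ⁿ_)
open import Data.Nat.Properties hiding (_≟_)
open import Algebra.Properties.CommutativeMonoid.Sum +-0-commutativeMonoid
  using (sum-cong-≗; sum-remove; sum-replicate-zero; ∑-distrib-+; ∑-comm)
open import Algebra.Properties.Semiring.Sum +-*-semiring
  using (*-distribˡ-sum; *-distribʳ-sum)
open import Data.Nat.Tactic.RingSolver using (solve-∀)
open import Data.Product using (∃; _,_; proj₁; proj₂; curry)
open import Data.Product.Properties using () renaming (≡-dec to ×-≡-dec)
open import Data.Sum using (_⊎_; inj₁; inj₂; [_,_]′; map₁; swap) renaming (map to ⊎-map)
open import Data.Sum.Properties using (≡-dec; inj₁-injective)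
open import Function using (flip; _∘_)
open import Function.Bundles using (mk⇔; Inverse)
open import Relation.Binary.Construct.Closure.ReflexiveTransitive using (ε; _◅_)
open import Relation.Binary.Construct.Closure.Symmetric using (fwd; bwd)
open import Relation.Binary.Construct.Closure.Transitive using (TransClosure; [_]; _∷_; _∷ʳ_)
open import Relation.Binary.PropositionalEquality
  using (refl; sym; trans; cong; cong₂; subst; subst₂; module ≡-Reasoning)
open import Relation.Nullary using (¬_; Dec; does; yes; no; contradiction)
open import Relation.Nullary.Decidable using (_⊎-dec_; decidable-stable)

-- Finite sums

sum-zero : ∀ {n} {f : Fin n → ℕ} → (∀ i → f i ≡ 0) → sum f ≡ 0
sum-zero {n} f≗0 = trans (sum-cong-≗ f≗0) (sum-replicate-zero n)

sum-single : ∀ {n} {f : Fin n → ℕ} i → (∀ j → j ≢ i → f j ≡ 0) → sum f ≡ f i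
sum-single {suc n} {f} i f≡0 = begin
  sum f                             ≡⟨ sum-remove f ⟩
  f i + ∑[ j < n ] f (punchIn i j)  ≡⟨ cong (f i +_) (sum-zero λ j → f≡0 _ (punchInᵢ≢i i j)) ⟩
  f i + 0                           ≡⟨ +-identityʳ (f i) ⟩
  f i                               ∎
  where open ≡-Reasoning

sum-support : ∀ {n} (f : Fin n → ℕ) → sum f ≡ 0 ⊎ ∃ λ i → f i ≢ 0
sum-support {zero}  f = inj₁ refl
sum-support {suc n} f with f zero in eq | sum-support (f ∘ suc)
... | suc _ | _              = inj₂ (zero , λ f0≡0 → 1+n≢0 (trans (sym eq) f0≡0))
... | zero  | inj₂ (i , fi≢0) = inj₂ (suc i , fi≢0)
... | zero  | inj₁ ∑≡0       = inj₁ ∑≡0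

module _ {m n : ℕ} where

  sum₂ : (Fin m → Fin n → ℕ) → ℕ
  sum₂ f = ∑[ i < m ] ∑[ j < n ] f i j

  sum₂-cong : ∀ {f g : Fin m → Fin n → ℕ} → (∀ i j → f i j ≡ g i j) → sum₂ f ≡ sum₂ g
  sum₂-cong f≗g = sum-cong-≗ λ i → sum-cong-≗ (f≗g i)

  sum₂-+ : ∀ f g → sum₂ (λ i j → f i j + g i j) ≡ sum₂ f + sum₂ g
  sum₂-+ f g = trans (sum-cong-≗ λ i → ∑-distrib-+ (f i) (g i))
    (∑-distrib-+ (λ i → sum (f i)) (λ i → sum (g i)))

  sum₂-* : ∀ (f : Fin m → ℕ) (g : Fin n → ℕ) → sum₂ (λ i j → g j * f i) ≡ sum g * sum f
  sum₂-* f g = begin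
    ∑[ i < m ] ∑[ j < n ] (g j * f i)  ≡⟨ sum-cong-≗ (λ i → *-distribʳ-sum (f i) g) ⟨
    ∑[ i < m ] (sum g * f i)         ≡⟨ *-distribˡ-sum (sum g) f ⟨
    sum g * sum f                    ∎
    where open ≡-Reasoning

  sum₂-single : ∀ {f : Fin m → Fin n → ℕ} i j →
    (∀ i′ j′ → (i′ , j′) ≢ (i , j) → f i′ j′ ≡ 0) → sum₂ f ≡ f i j
  sum₂-single i j f≡0 = trans
    (sum-single i λ i′ i′≢i → sum-zero λ j′ → f≡0 i′ j′ λ where refl → i′≢i refl)
    (sum-single j λ j′ j′≢j → f≡0 i j′ λ where refl → j′≢j refl)

  sum₂-zero : ∀ {f : Fin m → Fin n → ℕ} → (∀ i j → f i j ≡ 0) → sum₂ f ≡ 0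
  sum₂-zero f≗0 = sum-zero λ i → sum-zero (f≗0 i)

  sum₂-support : ∀ f → sum₂ f ≡ 0 ⊎ ∃ λ (p : Fin m × Fin n) → f (proj₁ p) (proj₂ p) ≢ 0
  sum₂-support f with sum-support (λ i → ∑[ j < n ] f i j)
  ... | inj₁ ∑≡0 = inj₁ ∑≡0
  ... | inj₂ (i , ∑≢0) with sum-support (f i)
  ...   | inj₁ ∑≡0         = contradiction ∑≡0 ∑≢0
  ...   | inj₂ (j , fij≢0) = inj₂ ((i , j) , fij≢0)

module _ {m n : ℕ} (g : Fin m × Fin n → ℕ) (x y : Fin m × Fin n) (x≢y : x ≢ y) where

  private
    _≟ₚ_ : (z w : Fin m × Fin n) → Dec (z ≡ w)
    _≟ₚ_ = ×-≡-dec _≟_ _≟_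

    only : Fin m × Fin n → Fin m × Fin n → ℕ
    only w z = if does (z ≟ₚ w) then g z else 0

    rest : Fin m × Fin n → ℕ
    rest z = if does ((z ≟ₚ x) ⊎-dec (z ≟ₚ y)) then 0 else g z

    sum-only : ∀ w → sum₂ (λ i j → only w (i , j)) ≡ g w
    sum-only w@(i , j) = trans (sum₂-single i j off) on
      where
      off : ∀ i′ j′ → (i′ , j′) ≢ w → only w (i′ , j′) ≡ 0
      off i′ j′ z≢w with (i′ , j′) ≟ₚ w
      ... | yes z≡w = contradiction z≡w z≢w
      ... | no _    = refl
      on : only w w ≡ g w
      on with w ≟ₚ w
      ... | yes _  = refl
      ... | no w≢w = contradiction refl w≢w

    split : ∀ z → g z ≡ only x z + only y z + rest z
    split z with z ≟ₚ x | z ≟ₚ y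
    ... | yes refl | yes refl = contradiction refl x≢y
    ... | yes _    | no _     = sym (trans (+-identityʳ _) (+-identityʳ _))
    ... | no _     | yes _    = sym (+-identityʳ _)
    ... | no _     | no _     = refl

    sum-split : sum₂ (curry g) ≡ g x + g y + sum₂ (curry rest)
    sum-split = begin
      sum₂ (curry g)
        ≡⟨ sum₂-cong (λ i j → split (i , j)) ⟩
      sum₂ (curry (λ z → only x z + only y z + rest z))
        ≡⟨ sum₂-+ (curry (λ z → only x z + only y z)) (curry rest) ⟩
      sum₂ (curry (λ z → only x z + only y z)) + sum₂ (curry rest)
        ≡⟨ cong (_+ sum₂ (curry rest)) (sum₂-+ (curry (only x)) (curry (only y))) ⟩
      sum₂ (curry (only x)) + sum₂ (curry (only y)) + sum₂ (curry rest)
        ≡⟨ cong (_+ sum₂ (curry rest)) (cong₂ _+_ (sum-only x) (sum-only y)) ⟩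
      g x + g y + sum₂ (curry rest)
        ∎
      where open ≡-Reasoning

  -- The summands at `x` and at `y` are split off; `x≢y` keeps them from being counted twice. The
  -- two points will be corners in the two triangles at an arc.
  sum₂-pair-≤ : g x + g y ≤ sum₂ (λ i j → g (i , j))
  sum₂-pair-≤ = subst (g x + g y ≤_) (sym sum-split) (m≤m+n _ _)

  sum₂-pair : (∀ z → z ≢ x → z ≢ y → g z ≡ 0) → sum₂ (λ i j → g (i , j)) ≡ g x + g y
  sum₂-pair g≡0 = trans sum-split
    (trans (cong (g x + g y +_) (sum₂-zero λ i j → rest≡0 (i , j))) (+-identityʳ _))
    where
    rest≡0 : ∀ z → rest z ≡ 0
    rest≡0 z with z ≟ₚ x | z ≟ₚ y
    ... | yes _  | _      = refl
    ... | no _   | yes _  = refl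
    ... | no z≢x | no z≢y = g≡0 z z≢x z≢y

-- Mutation of quivers

-- The pairs meeting `k` form a set closed under transposition, so reversal transposes that part of
-- the matrix and keeps its sum.
total-reverseAt : ∀ {n} k (G : Multigraph n) → sum₂ (reverseAt k G) ≡ sum₂ G
total-reverseAt {n} k G = begin
  sum₂ (reverseAt k G)                               ≡⟨ sum₂-cong split-reverse ⟩
  sum₂ (λ i j → touching j i + avoiding i j)         ≡⟨ sum₂-+ (flip touching) avoiding ⟩
  sum₂ (flip touching) + sum₂ avoiding               ≡⟨ cong (_+ sum₂ avoiding) (∑-comm (flip touching)) ⟩
  sum₂ touching + sum₂ avoiding                      ≡⟨ sum₂-+ touching avoiding ⟨
  sum₂ (λ i j → touching i j + avoiding i j)         ≡⟨ sum₂-cong split ⟨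
  sum₂ G                                             ∎
  where
  open ≡-Reasoning
  touches : Fin n → Fin n → Bool
  touches i j = does ((i ≟ k) ⊎-dec (j ≟ k))
  touching avoiding : Multigraph n
  touching i j = if touches i j then G i j else 0
  avoiding i j = if touches i j then 0 else G i j
  split : ∀ i j → G i j ≡ touching i j + avoiding i j
  split i j with touches i j
  ... | true  = sym (+-identityʳ _)
  ... | false = refl
  split-reverse : ∀ i j → reverseAt k G i j ≡ touching j i + avoiding i j
  -- `touching j i` tests its indices in the opposite order; commuting the disjunction lets one case
  -- split settle both tests.
  split-reverse i j rewrite ∨-comm (does (j ≟ k)) (does (i ≟ k)) with touches i j
  ... | true  = sym (+-identityʳ _)
  ... | false = refl

-- The change at a pair i, j: p and q arrows go i → j and j → i, and of the
-- composites i → j, s run against arrows of the triangles at k and o do not;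
-- s′ and o′ count those j → i.  Moving s′ to the left avoids a further ∸.
cancel-arrows : ∀ {p q s o s′ o′} →
  s + o ≡ 0 ⊎ s′ + o′ ≡ 0 → p ≡ 0 ⊎ q ≡ 0 → s ≤ q → s′ ≤ p →
  o ≡ 0 ⊎ q ≡ s → o′ ≡ 0 ⊎ p ≡ s′ →
  (p + (s + o)) ∸ (q + (s′ + o′)) + s′ ≡ p + o
cancel-arrows {q = q} {zero} {zero} (inj₁ refl) (inj₁ refl) s≤q z≤n o≡ o′≡ =
  trans (+-identityʳ _) (0∸n≡0 (q + _))
cancel-arrows {p} {s = zero} {zero} {s′} (inj₁ refl) (inj₂ refl) s≤q s′≤p o≡ (inj₁ refl)
  rewrite +-identityʳ p | +-identityʳ s′ = m∸n+n≡m s′≤p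
-- All `p` arrows are cancelled and the truncated difference is 0; the surviving composites j → i
-- are counted at the transposed pair.
cancel-arrows {p} {s = zero} {zero} {o′ = o′} (inj₁ refl) (inj₂ refl) s≤q s′≤p o≡ (inj₂ refl)
  rewrite +-identityʳ p | m≤n⇒m∸n≡0 (m≤m+n p o′) = refl
cancel-arrows {p} {q} {s} {o} {zero} {zero} (inj₂ refl) p⊎q s≤q s′≤p o≡ o′≡
  rewrite +-identityʳ q = trans (+-identityʳ _) (go p⊎q o≡)
  where
  go : p ≡ 0 ⊎ q ≡ 0 → o ≡ 0 ⊎ q ≡ s → p + (s + o) ∸ q ≡ p + o
  go (inj₁ refl) (inj₁ refl) rewrite +-identityʳ s = m≤n⇒m∸n≡0 s≤q
  go (inj₂ refl) (inj₁ refl) rewrite n≤0⇒n≡0 s≤q = refl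
  go _           (inj₂ refl) = begin
    p + (s + o) ∸ s  ≡⟨ cong (_∸ s) (+-assoc p s o) ⟨
    p + s + o ∸ s    ≡⟨ cong (λ t → t + o ∸ s) (+-comm p s) ⟩
    s + p + o ∸ s    ≡⟨ cong (_∸ s) (+-assoc s p o) ⟩
    s + (p + o) ∸ s  ≡⟨ m+n∸m≡n s (p + o) ⟩
    p + o            ∎
    where open ≡-Reasoning

-- `N` and `M` stand for the numbers of arrows before and after mutation. Factoring their difference
-- needs signs, so over ℕ the equation is kept additive and the four bits are enumerated.
unbalanced⇔degree-one : ∀ {M N α β γ δ} → α ≤ 1 → β ≤ 1 → γ ≤ 1 → δ ≤ 1 →
  M + (α * β + γ * δ) ≡ N + (α * δ + γ * β) →
  (β + δ ≡ 1 × α + γ ≡ 1) ⇔ (N ≢ M)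
unbalanced⇔degree-one {M} {N} = go
  where
  -- When both corrections reduce to the same `x`, cancelling it gives `M ≡ N`, so both sides of the
  -- equivalence are false.
  same : ∀ {x} {P : Set} → M + x ≡ N + x → ¬ P → P ⇔ (N ≢ M)
  same {x} eq ¬p =
    mk⇔ (λ p → contradiction p ¬p) (λ N≢M → contradiction (sym (+-cancelʳ-≡ x M N eq)) N≢M)

  x+1≢x+0 : ∀ {x} → x + 1 ≢ x + 0
  x+1≢x+0 {x} eq with +-cancelˡ-≡ x 1 0 eq
  ... | ()

  differ : ∀ {P : Set} → N ≢ M → P → P ⇔ (N ≢ M)
  differ N≢M p = mk⇔ (λ _ → N≢M) (λ _ → p)

  go : ∀ {α β γ δ} → α ≤ 1 → β ≤ 1 → γ ≤ 1 → δ ≤ 1 →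
    M + (α * β + γ * δ) ≡ N + (α * δ + γ * β) →
    (β + δ ≡ 1 × α + γ ≡ 1) ⇔ (N ≢ M)
  go z≤n       _         z≤n       _         eq = same eq λ ()
  go (s≤s z≤n) z≤n       (s≤s z≤n) z≤n       eq = same eq λ ()
  go (s≤s z≤n) z≤n       (s≤s z≤n) (s≤s z≤n) eq = same eq λ ()
  go (s≤s z≤n) (s≤s z≤n) (s≤s z≤n) z≤n       eq = same eq λ ()
  go (s≤s z≤n) (s≤s z≤n) (s≤s z≤n) (s≤s z≤n) eq = same eq λ ()
  go z≤n       z≤n       (s≤s z≤n) z≤n       eq = same eq λ ()
  go z≤n       (s≤s z≤n) (s≤s z≤n) (s≤s z≤n) eq = same eq λ ()
  go (s≤s z≤n) z≤n       z≤n       z≤n       eq = same eq λ ()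
  go (s≤s z≤n) (s≤s z≤n) z≤n       (s≤s z≤n) eq = same eq λ ()
  go z≤n       z≤n       (s≤s z≤n) (s≤s z≤n) eq = differ (λ where refl → x+1≢x+0 eq) (refl , refl)
  go (s≤s z≤n) (s≤s z≤n) z≤n       z≤n       eq = differ (λ where refl → x+1≢x+0 eq) (refl , refl)
  go z≤n       (s≤s z≤n) (s≤s z≤n) z≤n       eq = differ (λ where refl → x+1≢x+0 (sym eq)) (refl , refl)
  go (s≤s z≤n) z≤n       z≤n       (s≤s z≤n) eq = differ (λ where refl → x+1≢x+0 (sym eq)) (refl , refl)

module _ {n} (Q : Quiver n) (k : Fin n) (a b c d : Fin n → ℕ)
  (out : ∀ j → arrows Q k j ≡ a j + c j)
  (inc : ∀ i → arrows Q i k ≡ b i + d i)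
  where

  private
    A : Multigraph n
    A = arrows Q

    -- `s` counts the paths i → k → j that stay in one of the two triangles at `k`, `o` those that
    -- cross from one to the other.
    s o : Multigraph n
    s i j = a j * b i + c j * d i
    o i j = a j * d i + c j * b i

    composites : ∀ i j → A i k * A k j ≡ s i j + o i j
    composites i j = trans (cong₂ _*_ (inc i) (out j)) (expand (a j) (b i) (c j) (d i))
      where
      expand : ∀ α β γ δ → (β + δ) * (α + γ) ≡ (α * β + γ * δ) + (α * δ + γ * β)
      expand = solve-∀

    composites-at-k : ∀ {i j} → i ≡ k ⊎ j ≡ k → s i j + o i j ≡ 0
    composites-at-k {j = j} (inj₁ refl) =
      trans (sym (composites k j)) (cong (_* A k j) (noLoops Q k))
    composites-at-k {i} (inj₂ refl) =
      trans (sym (composites i k)) (trans (cong (A i k *_) (noLoops Q k)) (*-zeroʳ (A i k)))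

    -- Arrows between `i` and `k` point in one direction only, so paths through `k` cannot lead both
    -- from `i` to `j` and back.
    one-way : ∀ i j → s i j + o i j ≡ 0 ⊎ s j i + o j i ≡ 0
    one-way i j with noTwoCycles Q i k
    ... | inj₁ ik≡0 = inj₁ (trans (sym (composites i j)) (cong (_* A k j) ik≡0))
    ... | inj₂ ki≡0 =
      inj₂ (trans (sym (composites j i)) (trans (cong (A j k *_) ki≡0) (*-zeroʳ (A j k))))

    arrows-∸ : ∀ i j → A i j ∸ A j i ≡ A i j
    arrows-∸ i j with noTwoCycles Q i j
    ... | inj₁ ij≡0 rewrite ij≡0 = 0∸n≡0 (A j i)
    ... | inj₂ ji≡0 rewrite ji≡0 = refl

  module _
    -- For a triangulation, `s≤A` will hold because the third corner of each triangle at `k` is an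
    -- opposite arrow, and `A≡s` because a crossing path leaves room for no further opposite arrow.
    (s≤A : ∀ i j → s i j ≤ A j i)
    (A≡s : ∀ i j → o i j ≡ 0 ⊎ A j i ≡ s i j)
    where

    private
      -- A pair meeting `k` has its entry transposed and, as there are no loops at `k`, receives no
      -- composites; `s` and `o` drop out.
      at-k : ∀ i j → i ≡ k ⊎ j ≡ k →
        (A j i + A j k * A k i) ∸ (A i j + A i k * A k j) + s j i ≡ A j i + o i j
      at-k i j at = begin
        (A j i + A j k * A k i) ∸ (A i j + A i k * A k j) + s j i
          ≡⟨ cong₂ (λ u v → (A j i + u) ∸ (A i j + v) + s j i)
               (trans (composites j i) ji≡0) (trans (composites i j) ij≡0) ⟩
        (A j i + 0) ∸ (A i j + 0) + s j i
          ≡⟨ cong₂ (λ u v → u ∸ v + s j i) (+-identityʳ (A j i)) (+-identityʳ (A i j)) ⟩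
        A j i ∸ A i j + s j i
          ≡⟨ cong₂ _+_ (arrows-∸ j i) (m+n≡0⇒m≡0 (s j i) ji≡0) ⟩
        A j i + 0
          ≡⟨ cong (A j i +_) (m+n≡0⇒n≡0 (s i j) ij≡0) ⟨
        A j i + o i j
          ∎
        where
        open ≡-Reasoning
        ij≡0 = composites-at-k {i} {j} at
        ji≡0 = composites-at-k {j} {i} (swap at)

      -- Composites j → i inside a triangle cancel arrows i → j, whence the transposed `s j i`; it
      -- is added on the left in place of a subtraction on the right.
      pointwise : ∀ i j → arrows (mutate k Q) i j + s j i ≡ reverseAt k A i j + o i j
      pointwise i j with i ≟ k | j ≟ k
      ... | yes i≡k | yes _   = at-k i j (inj₁ i≡k)
      ... | yes i≡k | no _    = at-k i j (inj₁ i≡k)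
      ... | no _    | yes j≡k = at-k i j (inj₂ j≡k)
      ... | no _    | no _    rewrite composites i j | composites j i =
        cancel-arrows (one-way i j) (noTwoCycles Q i j) (s≤A i j) (s≤A j i) (A≡s i j) (A≡s j i)

    numArrows-mutate : numArrows (mutate k Q) + (sum a * sum b + sum c * sum d)
                       ≡ numArrows Q + (sum a * sum d + sum c * sum b)
    numArrows-mutate = begin
      sum₂ B + (sum a * sum b + sum c * sum d)
        ≡⟨ cong (sum₂ B +_) (trans (sum₂-+ (λ i j → a j * b i) (λ i j → c j * d i))
                              (cong₂ _+_ (sum₂-* b a) (sum₂-* d c))) ⟨
      sum₂ B + sum₂ s
        ≡⟨ cong (sum₂ B +_) (∑-comm s) ⟩
      sum₂ B + sum₂ (flip s)
        ≡⟨ sum₂-+ B (flip s) ⟨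
      sum₂ (λ i j → B i j + s j i)
        ≡⟨ sum₂-cong pointwise ⟩
      sum₂ (λ i j → reverseAt k A i j + o i j)
        ≡⟨ sum₂-+ (reverseAt k A) o ⟩
      sum₂ (reverseAt k A) + sum₂ o
        ≡⟨ cong₂ _+_ (total-reverseAt k A)
             (trans (sum₂-+ (λ i j → a j * d i) (λ i j → c j * b i))
                (cong₂ _+_ (sum₂-* d a) (sum₂-* b c))) ⟩
      sum₂ A + (sum a * sum d + sum c * sum b)
        ∎
      where
      open ≡-Reasoning
      B = arrows (mutate k Q)

    -- In the application each of the four sums is 1 for an arc and 0 for a boundary segment; by
    -- `out` and `inc`, each degree at `k` is a sum of two of them.
    degree-one-criterion : sum a ≤ 1 → sum b ≤ 1 → sum c ≤ 1 → sum d ≤ 1 →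
      (inDegree Q k ≡ 1 × outDegree Q k ≡ 1) ⇔ (numArrows Q ≢ numArrows (mutate k Q))
    degree-one-criterion a≤1 b≤1 c≤1 d≤1 = subst₂
      (λ x y → (x ≡ 1 × y ≡ 1) ⇔ (numArrows Q ≢ numArrows (mutate k Q)))
      (sym (trans (sum-cong-≗ inc) (∑-distrib-+ b d)))
      (sym (trans (sum-cong-≗ out) (∑-distrib-+ a c)))
      (unbalanced⇔degree-one a≤1 b≤1 c≤1 d≤1 numArrows-mutate)

-- Corners of a triangulation

module _ (G : Gluing) (unpunctured : Gluing.Unpunctured G) where

  open Gluing G hiding (arcs)

  private
    Arc : Set
    Arc = Fin (Gluing.arcs G)

    next³ : ∀ x → next (next (next x)) ≡ x
    next³ (_ , zero)          = refl
    next³ (_ , suc zero)      = refl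
    next³ (_ , suc (suc zero)) = refl

    next-injective : ∀ {x y} → next x ≡ next y → x ≡ y
    next-injective {x} {y} eq = trans (sym (next³ x)) (trans (cong (next ∘ next) eq) (next³ y))

    bank-injective : ∀ {x y} → bank x ≡ bank y → x ≡ y
    bank-injective {x} {y} eq =
      trans (sym (strictlyInverseʳ x)) (trans (cong from eq) (strictlyInverseʳ y))
      where open Inverse sides

    glued-sym : ∀ {x y} → GluedTo x y → GluedTo y x
    glued-sym (i , e , x≡ , y≡) = i , not e , y≡ ,
      trans x≡ (cong (λ e → inj₁ (i , e)) (sym (not-involutive e)))

    glued-functional : ∀ {x y z} → GluedTo x y → GluedTo x z → y ≡ z
    glued-functional (_ , _ , x≡ , y≡) (_ , _ , x≡′ , z≡) with trans (sym x≡) x≡′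
    ... | refl = bank-injective (trans y≡ (sym z≡))

    glued-injective : ∀ {x y z} → GluedTo x z → GluedTo y z → x ≡ y
    glued-injective x~z y~z = glued-functional (glued-sym x~z) (glued-sym y~z)

    label⇒bank : ∀ x {i} → label x ≡ inj₁ i → ∃ λ e → bank x ≡ inj₁ (i , e)
    label⇒bank x eq with bank x | eq
    ... | inj₁ (_ , e) | refl = e , refl

    -- An arc has just two banks, so two sides carrying it are the same bank or opposite ones.
    sameLabel : ∀ {x y i} → label x ≡ inj₁ i → label y ≡ inj₁ i → x ≡ y ⊎ GluedTo x y
    sameLabel {x} {y} {i} x≡ y≡ with label⇒bank x x≡ | label⇒bank y y≡
    ... | e , bx | e′ , by with e′ ≟ᵇ e
    ...   | yes refl  = inj₁ (bank-injective (trans bx (sym by)))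
    ...   | no e′≢e = inj₂ (i , e , bx , trans by (cong (λ e → inj₁ (i , e)) (¬-not e′≢e)))

    -- One step of the rotation about a vertex: the corner `x` is left across its side `next x`, and
    -- `y` is the corner entered.
    _↝_ : Side → Side → Set
    x ↝ y = GluedTo (next x) y

    _↝⁺_ : Side → Side → Set
    _↝⁺_ = TransClosure _↝_

    -- `↝` is a partial function, so a cycle at `x` starts with the step to `y`; moving this step to
    -- the end bases the cycle at `y`.
    cycle-forward : ∀ {x y} → x ↝ y → x ↝⁺ x → y ↝⁺ y
    cycle-forward x↝y [ x↝x ] with glued-functional x↝y x↝x
    ... | refl = [ x↝x ]
    cycle-forward x↝y (x↝z ∷ z↝⁺x) with glued-functional x↝y x↝z
    ... | refl = z↝⁺x ∷ʳ x↝y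

    -- `↝` is also injective, so the last step of a cycle at `y` comes from `x`.
    cycle-backward : ∀ {x y} → x ↝ y → y ↝⁺ y → x ↝⁺ x
    cycle-backward {x} {y} x↝y y↝⁺y = [ x↝y ∷_ , (λ where refl → y↝⁺y) ]′ (unsnoc y↝⁺y)
      where
      unsnoc : ∀ {w} → w ↝⁺ y → w ↝⁺ x ⊎ w ≡ x
      unsnoc [ w↝y ] = inj₂ (next-injective (glued-injective w↝y x↝y))
      unsnoc (w↝v ∷ v↝⁺y) with unsnoc v↝⁺y
      ... | inj₁ v↝⁺x = inj₁ (w↝v ∷ v↝⁺x)
      ... | inj₂ refl = inj₁ [ w↝v ]

    -- A cycle can be carried to every corner at the same point, in particular to one next to the
    -- boundary. That corner has no predecessor or no successor.
    acyclic : ∀ {x} → ¬ (x ↝⁺ x)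
    acyclic {x} x↝⁺x with unpunctured x
    ... | y , x∼y , onBoundary = [ target , source ]′ onBoundary
      where
      transport : ∀ {x} → SamePoint x y → x ↝⁺ x → y ↝⁺ y
      transport ε                = λ c → c
      transport (fwd x↝z ◅ z∼y) = transport z∼y ∘ cycle-forward x↝z
      transport (bwd z↝x ◅ z∼y) = transport z∼y ∘ cycle-backward z↝x

      last : ∀ {w} → w ↝⁺ y → ∃ λ v → v ↝ y
      last [ w↝y ]    = _ , w↝y
      last (_ ∷ v↝⁺y) = last v↝⁺y

      first : ∀ {w} → y ↝⁺ w → ∃ λ v → y ↝ v
      first [ y↝w ]   = _ , y↝w
      first (y↝v ∷ _) = _ , y↝v

      target : ¬ OnBoundary y
      target (_ , y≡₂) with last (transport x∼y x↝⁺x)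
      ... | _ , _ , _ , _ , y≡₁ with trans (sym y≡₁) y≡₂
      ...   | ()

      source : ¬ OnBoundary (next y)
      source (_ , y≡₂) with first (transport x∼y x↝⁺x)
      ... | _ , _ , _ , y≡₁ , _ with trans (sym y≡₁) y≡₂
      ...   | ()

    -- Otherwise the corner `x` would be glued to itself, a cycle of length one.
    not-self-folded : ∀ x {i} → label x ≡ inj₁ i → label (next x) ≢ inj₁ i
    not-self-folded x {i} x≡ nx≡ with sameLabel nx≡ x≡
    ... | inj₂ x↝x = acyclic [ x↝x ]
    ... | inj₁ nx≡x = next≢ x nx≡x
      where
      next≢ : ∀ x → next x ≢ x
      next≢ (_ , zero) ()
      next≢ (_ , suc zero) ()
      next≢ (_ , suc (suc zero)) ()

    -- In the generic case the corners `x` and `y` would be glued to each other on both sides, a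
    -- cycle of length two.
    no-opposite-turns : ∀ x y {i j} → label x ≡ inj₁ i → label (next x) ≡ inj₁ j →
      label y ≡ inj₁ j → label (next y) ≢ inj₁ i
    no-opposite-turns x y x≡ nx≡ y≡ ny≡ with sameLabel nx≡ y≡ | sameLabel ny≡ x≡
    -- If the sides coincide, both turns lie in one triangle, which then has one arc on two of its
    -- sides.
    ... | inj₁ refl | _         = not-self-folded (next (next x)) ny≡ (trans (cong label (next³ x)) x≡)
    ... | inj₂ _    | inj₁ refl = not-self-folded (next (next y)) nx≡ (trans (cong label (next³ y)) y≡)
    ... | inj₂ x↝y  | inj₂ y↝x  = acyclic (x↝y ∷ [ y↝x ])

    -- The corner from c to b would close up the corners b → k and k → c.
    no-opposite-corner : ∀ x y z {i j} → GluedTo x y →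
      label (next (next x)) ≡ inj₁ i → label (next y) ≡ inj₁ j →
      label z ≡ inj₁ j → label (next z) ≡ inj₁ i → z ≡ next x ⊎ z ≡ next y
    no-opposite-corner x y z x~y b≡ c≡ z≡ nz≡ with sameLabel nz≡ b≡ | sameLabel c≡ z≡
    -- A side of `z` may be the given side itself and not its other bank. Then `z` is a corner of
    -- one of the two triangles, which happens only if they share a second arc.
    ... | inj₁ nz≡b | _         = inj₁ (next-injective nz≡b)
    ... | inj₂ _    | inj₁ refl = inj₂ refl
    ... | inj₂ z↝b  | inj₂ y↝z  =
      contradiction (z↝b ∷ subst (λ w → GluedTo w y) (sym (next³ x)) x~y ∷ [ y↝z ]) acyclic

    -- Turns as products of indicator functions

    _≟ₗ_ : (l m : Arc ⊎ Fin segments) → Dec (l ≡ m)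
    _≟ₗ_ = ≡-dec _≟_ _≟_

    e : Side → Arc → ℕ
    e x i = if does (label x ≟ₗ inj₁ i) then 1 else 0

    e-on : ∀ x {i} → label x ≡ inj₁ i → e x i ≡ 1
    e-on x {i} x≡ with label x ≟ₗ inj₁ i
    ... | yes _ = refl
    ... | no x≢ = contradiction x≡ x≢

    e-support : ∀ x i → e x i ≢ 0 → label x ≡ inj₁ i
    e-support x i e≢0 with label x ≟ₗ inj₁ i
    ... | yes x≡ = x≡
    ... | no _   = contradiction refl e≢0

    e*e-support : ∀ x y i j → e x i * e y j ≢ 0 → label x ≡ inj₁ i × label y ≡ inj₁ j
    e*e-support x y i j ≢0 =
        e-support x i (λ x≡0 → ≢0 (cong (_* e y j) x≡0))
      , e-support y j (λ y≡0 → ≢0 (trans (cong (e x i *_) y≡0) (*-zeroʳ (e x i))))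

    sum-e≤1 : ∀ x → sum (e x) ≤ 1
    sum-e≤1 x with sum-support (e x)
    ... | inj₁ ∑≡0 = ≤-trans (≤-reflexive ∑≡0) z≤n
    ... | inj₂ (i , e≢0) = ≤-reflexive (trans (sum-single i off) (e-on x x≡))
      where
      x≡ = e-support x i e≢0
      off : ∀ j → j ≢ i → e x j ≡ 0
      off j j≢i with label x ≟ₗ inj₁ j
      ... | yes x≡′ = contradiction (inj₁-injective (trans (sym x≡′) x≡)) j≢i
      ... | no _    = refl

    -- The product form makes the terms of `s` values of `turn` at the corners opposite to `k`.
    turn : Arc → Arc → Side → ℕ
    turn i j x = e x i * e (next x) j

    turns≡sum-turn : ∀ i j → turns i j ≡ sum₂ (λ t c → turn i j (t , c))
    turns≡sum-turn i j = sum₂-cong λ t c →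
      if-∧ (does (label (t , c) ≟ₗ inj₁ i)) (does (label (next (t , c)) ≟ₗ inj₁ j))
      where
      if-∧ : ∀ p q → (if p ∧ q then 1 else 0) ≡ (if p then 1 else 0) * (if q then 1 else 0)
      if-∧ false _     = refl
      if-∧ true  false = refl
      if-∧ true  true  = refl

    turns-support : ∀ i j → turns i j ≡ 0 ⊎ ∃ λ x → label x ≡ inj₁ i × label (next x) ≡ inj₁ j
    turns-support i j with sum₂-support (λ t c → turn i j (t , c))
    ... | inj₁ ∑≡0 = inj₁ (trans (turns≡sum-turn i j) ∑≡0)
    ... | inj₂ (x , ≢0) = inj₂ (x , e*e-support x (next x) i j ≢0)

    turns-noTwoCycles : ∀ i j → turns i j ≡ 0 ⊎ turns j i ≡ 0
    turns-noTwoCycles i j with turns-support i j | turns-support j i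
    ... | inj₁ ij≡0 | _         = inj₁ ij≡0
    ... | inj₂ _    | inj₁ ji≡0 = inj₂ ji≡0
    ... | inj₂ (x , x≡ , nx≡) | inj₂ (y , y≡ , ny≡) =
      contradiction ny≡ (no-opposite-turns x y x≡ nx≡ y≡)

    -- The turns contain no 2-cycles, so the truncated subtraction removes nothing.
    arrows≡turns : ∀ i j → arrows (removeTwoCycles turns) i j ≡ turns i j
    arrows≡turns i j with turns-noTwoCycles i j
    ... | inj₁ ij≡0 rewrite ij≡0 = 0∸n≡0 (turns j i)
    ... | inj₂ ji≡0 rewrite ji≡0 = refl

    turns≡pair : ∀ i j x y → x ≢ y →
      (∀ z → label z ≡ inj₁ i → label (next z) ≡ inj₁ j → z ≡ x ⊎ z ≡ y) →
      turns i j ≡ turn i j x + turn i j y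
    turns≡pair i j x y x≢y only = trans (turns≡sum-turn i j) (sum₂-pair (turn i j) x y x≢y off)
      where
      off : ∀ z → z ≢ x → z ≢ y → turn i j z ≡ 0
      -- Equality with 0 is decidable, so it may be shown by contradiction: a non-zero turn forces
      -- both labels, and `only` applies.
      off z z≢x z≢y = decidable-stable (turn i j z ≟ⁿ 0) λ ≢0 →
        let z≡ , nz≡ = e*e-support z (next z) i j ≢0 in [ z≢x , z≢y ]′ (only z z≡ nz≡)

  -- The two triangles at an arc

  module _ (k : Arc) where

    private
      x₀ y₀ a b c d : Side
      x₀ = Inverse.from sides (inj₁ (k , true))
      y₀ = Inverse.from sides (inj₁ (k , false))
      a = next x₀
      b = next a
      c = next y₀
      d = next c

      bank-x₀ : bank x₀ ≡ inj₁ (k , true)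
      bank-x₀ = Inverse.strictlyInverseˡ sides _

      bank-y₀ : bank y₀ ≡ inj₁ (k , false)
      bank-y₀ = Inverse.strictlyInverseˡ sides _

      label-x₀ : label x₀ ≡ inj₁ k
      label-x₀ = cong (map₁ proj₁) bank-x₀

      label-y₀ : label y₀ ≡ inj₁ k
      label-y₀ = cong (map₁ proj₁) bank-y₀

      x₀~y₀ : GluedTo x₀ y₀
      x₀~y₀ = k , true , bank-x₀ , bank-y₀

      x₀≢y₀ : x₀ ≢ y₀
      x₀≢y₀ eq with trans (sym bank-x₀) (trans (cong bank eq) bank-y₀)
      ... | ()

      sides-of-k : ∀ z → label z ≡ inj₁ k → z ≡ x₀ ⊎ z ≡ y₀
      sides-of-k z z≡ with sameLabel label-x₀ z≡
      ... | inj₁ x₀≡z = inj₁ (sym x₀≡z)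
      ... | inj₂ x₀~z = inj₂ (glued-functional x₀~z x₀~y₀)

      a≢c : a ≢ c
      a≢c = x₀≢y₀ ∘ next-injective

      b≢d : b ≢ d
      b≢d = a≢c ∘ next-injective

      Q : Quiver (Gluing.arcs G)
      Q = removeTwoCycles turns

      out : ∀ j → arrows Q k j ≡ e a j + e c j
      out j = begin
        arrows Q k j             ≡⟨ arrows≡turns k j ⟩
        turns k j                ≡⟨ turns≡pair k j x₀ y₀ x₀≢y₀ (λ z z≡ _ → sides-of-k z z≡) ⟩
        turn k j x₀ + turn k j y₀ ≡⟨ cong₂ _+_ (first x₀ label-x₀) (first y₀ label-y₀) ⟩
        e a j + e c j            ∎
        where
        open ≡-Reasoning
        first : ∀ x → label x ≡ inj₁ k → turn k j x ≡ e (next x) j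
        first x x≡ = trans (cong (_* e (next x) j) (e-on x x≡)) (*-identityˡ _)

      inc : ∀ i → arrows Q i k ≡ e b i + e d i
      inc i = begin
        arrows Q i k             ≡⟨ arrows≡turns i k ⟩
        turns i k                ≡⟨ turns≡pair i k b d b≢d (λ z _ nz≡ → before z (sides-of-k (next z) nz≡)) ⟩
        turn i k b + turn i k d  ≡⟨ cong₂ _+_ (second x₀ label-x₀) (second y₀ label-y₀) ⟩
        e b i + e d i            ∎
        where
        open ≡-Reasoning
        prev : ∀ {z x} → next z ≡ x → z ≡ next (next x)
        prev {z} nz≡x = trans (sym (next³ z)) (cong (next ∘ next) nz≡x)
        before : ∀ z → next z ≡ x₀ ⊎ next z ≡ y₀ → z ≡ b ⊎ z ≡ d
        before z = ⊎-map prev prev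
        second : ∀ x → label x ≡ inj₁ k → turn i k (next (next x)) ≡ e (next (next x)) i
        second x x≡ = trans
          (cong (e (next (next x)) i *_) (e-on _ (trans (cong label (next³ x)) x≡)))
          (*-identityʳ _)

      -- The two products are the summands of `turns j i` at the corners `a` and `c`; other
      -- triangles may contribute more.
      corners≤arrows : ∀ i j → e a j * e b i + e c j * e d i ≤ arrows Q j i
      corners≤arrows i j = subst (turn j i a + turn j i c ≤_)
        (sym (trans (arrows≡turns j i) (turns≡sum-turn j i)))
        (sum₂-pair-≤ (turn j i) a c a≢c)

      -- If a crossing product is non-zero, `no-opposite-corner` leaves only `a` and `c` as possible
      -- turns from `j` to `i`.
      corners≡arrows : ∀ i j → e a j * e d i + e c j * e b i ≡ 0
        ⊎ arrows Q j i ≡ e a j * e b i + e c j * e d i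
      corners≡arrows i j with e a j * e d i ≟ⁿ 0 | e c j * e b i ≟ⁿ 0
      ... | yes ad≡0 | yes cb≡0 = inj₁ (cong₂ _+_ ad≡0 cb≡0)
      -- The path d → k → a crosses in the other direction, so the two triangles exchange roles and
      -- `swap` restores their order.
      ... | no ad≢0  | _ = inj₂ (trans (arrows≡turns j i) (turns≡pair j i a c a≢c λ z z≡ nz≡ →
        let a≡ , d≡ = e*e-support a d j i ad≢0 in
        swap (no-opposite-corner y₀ x₀ z (glued-sym x₀~y₀) d≡ a≡ z≡ nz≡)))
      ... | yes _    | no cb≢0 = inj₂ (trans (arrows≡turns j i) (turns≡pair j i a c a≢c λ z z≡ nz≡ →
        let c≡ , b≡ = e*e-support c b j i cb≢0 in
        no-opposite-corner x₀ y₀ z x₀~y₀ b≡ c≡ z≡ nz≡))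

    turns-degree-one-criterion :
      (inDegree (removeTwoCycles turns) k ≡ 1 × outDegree (removeTwoCycles turns) k ≡ 1)
      ⇔ (numArrows (removeTwoCycles turns) ≢ numArrows (mutate k (removeTwoCycles turns)))
    turns-degree-one-criterion = degree-one-criterion Q k (e a) (e b) (e c) (e d) out inc
      corners≤arrows corners≡arrows (sum-e≤1 a) (sum-e≤1 b) (sum-e≤1 c) (sum-e≤1 d)

proposition3p1 : (T : Triangulation) (k : Fin (arcs T)) →
    (inDegree (quiver T) k ≡ 1 × outDegree (quiver T) k ≡ 1)
    ⇔ (numArrows (quiver T) ≢ numArrows (mutate k (quiver T)))
proposition3p1 T = turns-degree-one-criterion (Triangulation.gluing T) (Triangulation.unpunctured T)
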